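{- Let $c$ be the Conway map from Conway forms to classical short normal-play games and let $c^{ -1}$ be the map from classical short normal-play games to Conway forms, both defined in the context. (1) For any Conway forms $G,H$, if $G\geqslant H$ in the order of affine games, then $c(G)\geqslant c(H)$ in the order of classical normal play. (2) For any classical short normal-play games $G,H$, if $G\geqslant H$ in the order of classical normal play, then $c^{ -1}(G)\geqslant c^{ -1}(H)$ in the order of affine games.
   Context: Affine games are defined recursively. There are two games without options, denoted $\infty$ and $\overline{\infty}$ (terminating games). Every other affine game is a form $G=\{G^{\mathcal L}\mid G^{\mathcal R}\}$, where $G^{\mathcal L}$ (Left options) and $G^{\mathcal R}$ (Right options) are non-empty finite sets of previously constructed affine games. Let $\mathbb A$ be the set of all affine games. The followers of $G$ are $G$ itself and all games reachable from $G$ by a finite sequence of (not necessarily alternating) moves to options. Disjunctive sum: $G+H$ is undefined if one of $G,H$ is $\infty$ and the other is $\overline\infty$; it is $\infty$ if one is $\infty$ and the other is not $\overline\infty$; it is $\overline\infty$ if one is $\overline\infty$ and the other is not $\infty$; otherwise $G+H=\{G^{\mathcal L}+H,\,G+H^{\mathcal L}\mid G^{\mathcal R}+H,\,G+H^{\mathcal R}\}$. Outcomes: $o^L(G)=\mathbf L$ if $G=\infty$ or some $G^L\in G^{\mathcal L}$ has $o^R(G^L)=\mathbf L$, and $o^L(G)=\mathbf R$ otherwise; $o^R(G)=\mathbf R$ if $G=\overline\infty$ or some $G^R\in G^{\mathcal R}$ has $o^L(G^R)=\mathbf R$, and $o^R(G)=\mathbf L$ otherwise. With $\mathbf L>\mathbf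 R$, the outcome $o(G)=(o^L(G),o^R(G))$ is ordered componentwise. Order of affine games: $G\geqslant H$ iff $o(G+X)\geqslant o(H+X)$ for all $X\in\mathbb A\setminus\{\infty,\overline\infty\}$. A game is a check if $\infty$ is one of its Left options or $\overline\infty$ is one of its Right options. A Conway form is an affine game form that is distinct from $\infty$ and $\overline\infty$ and has no checks as followers. Classical normal play: short (finite, loop-free) partizan games $\{G^{\mathcal L}\mid G^{\mathcal R}\}$ with finite, possibly empty, option sets, where the player unable to move loses, with the usual partial order ($G\geqslant H$ iff Left wins $G-H$ playing second). Conway map $c$ (recursive, from Conway forms to classical normal-play games): $c(G)=\{\emptyset\mid\emptyset\}$ if $G=\{\overline\infty\mid\infty\}$; $c(G)=\{\emptyset\mid c(G^{\mathcal R})\}$ if $G=\{\overline\infty\mid G^{\mathcal R}\}$ and $G^{\mathcal R}\neq\{\infty\}$; $c(G)=\{c(G^{\mathcal L})\mid\emptyset\}$ if $G=\{G^{\mathcal L}\mid\infty\}$ and $G^{\mathcal L}\neq\{\overline\infty\}$; and $c(G)=\{c(G^{\mathcal L})\mid c(G^{\mathcal R})\}$ otherwise. Here $c(G^{\mathcal L})$ means $\{c(G^L):G^L\in G^{\mathcal L}\}$, and likewise $c(G^{\mathcal R})$ means $\{c(G^R):G^R\in G^{\mathcal R}\}$. The map $c^{ -1}$ (recursive, from classical normal-play games to Conway forms): $c^{ -1}(G)=\{\overline\infty\mid\infty\}$ if $G=\{\emptyset\mid\emptyset\}$; $c^{ -1}(G)=\{\overline\infty\mid c^{ -1}(G^{\mathcal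 R})\}$ if $G=\{\emptyset\mid G^{\mathcal R}\}$ and $G^{\mathcal R}\ne\emptyset$; $c^{ -1}(G)=\{c^{ -1}(G^{\mathcal L})\mid\infty\}$ if $G=\{G^{\mathcal L}\mid\emptyset\}$ and $G^{\mathcal L}\neq\emptyset$; and $c^{ -1}(G)=\{c^{ -1}(G^{\mathcal L})\mid c^{ -1}(G^{\mathcal R})\}$ otherwise, with $c^{ -1}$ applied to each option of the set. -}

module Defs where

open import Data.Bool.Base using (if_then_else_)
open import Data.Empty using (⊥; ⊥-elim-irr)
open import Data.Fin.Base using (Fin)
open import Data.Fin.Properties using (any?)
open import Data.List.Base using (catMaybes)
open import Data.Maybe.Base using (Maybe; just; nothing)
open import Data.Nat.Base using (zero; suc)
open import Data.Product.Base using (∃; _×_; _,_)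
open import Data.Product.Relation.Binary.Pointwise.NonDependent using (Pointwise)
open import Data.Sum.Base using (_⊎_; inj₁; inj₂)
open import Data.Vec.Functional using (Vector; _++_; toList; fromList)
open import Relation.Binary.Construct.Closure.ReflexiveTransitive using (Star; ε; _◅_)
open import Relation.Binary.Definitions using (DecidableEquality)
open import Relation.Binary.PropositionalEquality using (_≡_; refl)
open import Relation.Nullary using (¬_; does; yes; no)

------------------------------------------------------------------------
-- Affine games

-- A finite set of options is the image of a finite family: order and
-- repetition never matter below.  The index suc makes it non-empty.

data Game : Set where
  ∞ ∞̄   : Game
  ⟨_∣_⟩ : ∀ {m n} → Vector Game (suc m) → Vector Game (suc n) → Game

data NonTerminal : Game → Set where
  form : ∀ {m n} {ls : Vector Game (suc m)} {rs : Vector Game (suc n)} →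
         NonTerminal ⟨ ls ∣ rs ⟩

Option : Game → Game → Set
Option ∞           F = ⊥
Option ∞̄           F = ⊥
Option ⟨ ls ∣ rs ⟩ F = (∃ λ i → ls i ≡ F) ⊎ (∃ λ j → rs j ≡ F)

Follower : Game → Game → Set
Follower = Star Option

Check : Game → Set
Check ∞           = ⊥
Check ∞̄           = ⊥
Check ⟨ ls ∣ rs ⟩ = (∃ λ i → ls i ≡ ∞) ⊎ (∃ λ j → rs j ≡ ∞̄)

record ConwayForm : Set where
  field
    game        : Game
    nonTerminal : NonTerminal game
    noChecks    : ∀ {F} → Follower game F → ¬ Check F

-- The disjunctive sum is partial: it is undefined exactly on the pairs
-- excluded here.

Summable : Game → Game → Set
Summable G H = ¬ ((G ≡ ∞ × H ≡ ∞̄) ⊎ (G ≡ ∞̄ × H ≡ ∞))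

summableˡ : ∀ {G H} → NonTerminal G → Summable G H
summableˡ form (inj₁ (() , _))
summableˡ form (inj₂ (() , _))

summableʳ : ∀ {G H} → NonTerminal H → Summable G H
summableʳ form (inj₁ (_ , ()))
summableʳ form (inj₂ (_ , ()))

sum : (G H : Game) → .(Summable G H) → Game
sum ∞             ∞             d = ∞
sum ∞             ∞̄             d = ⊥-elim-irr (d (inj₁ (refl , refl)))
sum ∞             ⟨ _ ∣ _ ⟩     d = ∞
sum ∞̄             ∞             d = ⊥-elim-irr (d (inj₂ (refl , refl)))
sum ∞̄             ∞̄             d = ∞̄
sum ∞̄             ⟨ _ ∣ _ ⟩     d = ∞̄
sum ⟨ _ ∣ _ ⟩     ∞             d = ∞
sum ⟨ _ ∣ _ ⟩     ∞̄             d = ∞̄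
sum G@(⟨ gl ∣ gr ⟩) H@(⟨ hl ∣ hr ⟩) d =
  ⟨ (λ i → sum (gl i) H (summableʳ form)) ++ (λ i → sum G (hl i) (summableˡ form))
  ∣ (λ j → sum (gr j) H (summableʳ form)) ++ (λ j → sum G (hr j) (summableˡ form))
  ⟩

data Winner : Set where
  𝐋 𝐑 : Winner

_≟_ : DecidableEquality Winner
𝐋 ≟ 𝐋 = yes refl
𝐋 ≟ 𝐑 = no λ ()
𝐑 ≟ 𝐋 = no λ ()
𝐑 ≟ 𝐑 = yes refl

infix 4 _≟_ _≥ʷ_ _≥ᵒ_ _≥ᴬ_ _≥ᴺ_

data _≥ʷ_ : Winner → Winner → Set where
  ≥-refl : ∀ {w} → w ≥ʷ w
  𝐋≥𝐑    : 𝐋 ≥ʷ 𝐑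

oᴸ oᴿ : Game → Winner

oᴸ ∞           = 𝐋
oᴸ ∞̄           = 𝐑
oᴸ ⟨ ls ∣ rs ⟩ = if does (any? λ i → oᴿ (ls i) ≟ 𝐋) then 𝐋 else 𝐑

oᴿ ∞           = 𝐋
oᴿ ∞̄           = 𝐑
oᴿ ⟨ ls ∣ rs ⟩ = if does (any? λ j → oᴸ (rs j) ≟ 𝐑) then 𝐑 else 𝐋

o : Game → Winner × Winner
o G = oᴸ G , oᴿ G

_≥ᵒ_ : Winner × Winner → Winner × Winner → Set
_≥ᵒ_ = Pointwise _≥ʷ_ _≥ʷ_

_≥ᴬ_ : Game → Game → Set
G ≥ᴬ H = ∀ X (nt : NonTerminal X) →
         o (sum G X (summableʳ nt)) ≥ᵒ o (sum H X (summableʳ nt))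

------------------------------------------------------------------------
-- Classical normal-play games

data Short : Set where
  ⟪_∣_⟫ : ∀ {m n} → Vector Short m → Vector Short n → Short

-_ : Short → Short
- ⟪ ls ∣ rs ⟫ = ⟪ (λ j → - (rs j)) ∣ (λ i → - (ls i)) ⟫

_+_ : Short → Short → Short
G@(⟪ gl ∣ gr ⟫) + H@(⟪ hl ∣ hr ⟫) =
  ⟪ (λ i → gl i + H) ++ (λ i → G + hl i)
  ∣ (λ j → gr j + H) ++ (λ j → G + hr j)
  ⟫

_-_ : Short → Short → Short
G - H = G + (- H)

LeftWinsFirst LeftWinsSecond : Short → Set
LeftWinsFirst  ⟪ ls ∣ rs ⟫ = ∃ λ i → LeftWinsSecond (ls i)
LeftWinsSecond ⟪ ls ∣ rs ⟫ = ∀ j → LeftWinsFirst (rs j)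

_≥ᴺ_ : Short → Short → Set
G ≥ᴺ H = LeftWinsSecond (G - H)

------------------------------------------------------------------------
-- The Conway map

-- Terminal options contribute nothing, so {∞̄} as set of Left options and
-- {∞} as set of Right options become ∅; one clause thus covers the four
-- cases of the recursion.  A Conway form may also have ∞̄ among several
-- Left options (or ∞ among several Right options), where c ∞̄ has no
-- meaning of its own; such an option is dropped as well.  The other
-- terminal options (∞ for Left, ∞̄ for Right) do not occur in the
-- followers of a Conway form.

convert     : Game → Maybe Short
convertForm : ∀ {m n} → Vector Game m → Vector Game n → Short

convert ∞           = nothing
convert ∞̄           = nothing
convert ⟨ ls ∣ rs ⟩ = just (convertForm ls rs)

convertForm ls rs =
  ⟪ fromList (catMaybes (toList λ i → convert (ls i)))
  ∣ fromList (catMaybes (toList λ j → convert (rs j)))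
  ⟫

c : ConwayForm → Short
c record { game = ∞ ; nonTerminal = () }
c record { game = ∞̄ ; nonTerminal = () }
c record { game = ⟨ ls ∣ rs ⟩ } = convertForm ls rs

------------------------------------------------------------------------
-- The map c⁻¹

embed : Short → Game
embed (⟪_∣_⟫ {zero}  {zero}  ls rs) = ⟨ (λ (_ : Fin 1) → ∞̄) ∣ (λ (_ : Fin 1) → ∞) ⟩
embed (⟪_∣_⟫ {zero}  {suc n} ls rs) = ⟨ (λ (_ : Fin 1) → ∞̄) ∣ (λ j → embed (rs j)) ⟩
embed (⟪_∣_⟫ {suc m} {zero}  ls rs) = ⟨ (λ i → embed (ls i)) ∣ (λ (_ : Fin 1) → ∞) ⟩
embed (⟪_∣_⟫ {suc m} {suc n} ls rs) = ⟨ (λ i → embed (ls i)) ∣ (λ j → embed (rs j)) ⟩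

embed-nonTerminal : ∀ G → NonTerminal (embed G)
embed-nonTerminal (⟪_∣_⟫ {zero}  {zero}  ls rs) = form
embed-nonTerminal (⟪_∣_⟫ {zero}  {suc n} ls rs) = form
embed-nonTerminal (⟪_∣_⟫ {suc m} {zero}  ls rs) = form
embed-nonTerminal (⟪_∣_⟫ {suc m} {suc n} ls rs) = form

embed≢∞ : ∀ G → ¬ (embed G ≡ ∞)
embed≢∞ G eq with embed G | embed-nonTerminal G
embed≢∞ G () | _ | form

embed≢∞̄ : ∀ G → ¬ (embed G ≡ ∞̄)
embed≢∞̄ G eq with embed G | embed-nonTerminal G
embed≢∞̄ G () | _ | form

embed-¬check : ∀ G → ¬ Check (embed G)
embed-¬check (⟪_∣_⟫ {zero}  {zero}  ls rs) (inj₁ (_ , ()))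
embed-¬check (⟪_∣_⟫ {zero}  {zero}  ls rs) (inj₂ (_ , ()))
embed-¬check (⟪_∣_⟫ {zero}  {suc n} ls rs) (inj₁ (_ , ()))
embed-¬check (⟪_∣_⟫ {zero}  {suc n} ls rs) (inj₂ (j , eq)) = embed≢∞̄ (rs j) eq
embed-¬check (⟪_∣_⟫ {suc m} {zero}  ls rs) (inj₁ (i , eq)) = embed≢∞ (ls i) eq
embed-¬check (⟪_∣_⟫ {suc m} {zero}  ls rs) (inj₂ (_ , ()))
embed-¬check (⟪_∣_⟫ {suc m} {suc n} ls rs) (inj₁ (i , eq)) = embed≢∞ (ls i) eq
embed-¬check (⟪_∣_⟫ {suc m} {suc n} ls rs) (inj₂ (j , eq)) = embed≢∞̄ (rs j) eq

∞-noChecks : ∀ {F} → Follower ∞ F → ¬ Check F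
∞-noChecks ε ()

∞̄-noChecks : ∀ {F} → Follower ∞̄ F → ¬ Check F
∞̄-noChecks ε ()

embed-noChecks : ∀ G {F} → Follower (embed G) F → ¬ Check F
embed-noChecks G ε = embed-¬check G
embed-noChecks (⟪_∣_⟫ {zero}  {zero}  ls rs) (inj₁ (_ , refl) ◅ p) = ∞̄-noChecks p
embed-noChecks (⟪_∣_⟫ {zero}  {zero}  ls rs) (inj₂ (_ , refl) ◅ p) = ∞-noChecks p
embed-noChecks (⟪_∣_⟫ {zero}  {suc n} ls rs) (inj₁ (_ , refl) ◅ p) = ∞̄-noChecks p
embed-noChecks (⟪_∣_⟫ {zero}  {suc n} ls rs) (inj₂ (j , refl) ◅ p) = embed-noChecks (rs j) p
embed-noChecks (⟪_∣_⟫ {suc m} {zero}  ls rs) (inj₁ (i , refl) ◅ p) = embed-noChecks (ls i) p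
embed-noChecks (⟪_∣_⟫ {suc m} {zero}  ls rs) (inj₂ (_ , refl) ◅ p) = ∞-noChecks p
embed-noChecks (⟪_∣_⟫ {suc m} {suc n} ls rs) (inj₁ (i , refl) ◅ p) = embed-noChecks (ls i) p
embed-noChecks (⟪_∣_⟫ {suc m} {suc n} ls rs) (inj₂ (j , refl) ◅ p) = embed-noChecks (rs j) p

c⁻¹ : Short → ConwayForm
c⁻¹ G = record
  { game        = embed G
  ; nonTerminal = embed-nonTerminal G
  ; noChecks    = embed-noChecks G
  }

{-# OPTIONS --safe #-}

-- A game and a classical game correspond when their options match
-- recursively, up to the suicidal options ∞̄ for Left and ∞ for Right; both
-- c and c⁻¹ only relate corresponding games.  As suicidal options never
-- help their mover, Left's winning strategies carry over from an affine sum
-- to the sum of the corresponding classical games.  For (1), the test game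
-- X = c⁻¹(- c(H)) suffices: Left wins H + X moving second by mirroring,
-- hence also G + X, hence c(G) - c(H).  For (2), a winning strategy of Left
-- moving second on G - H is combined with one on H + X into one on G + X;
-- X may be any affine game.

module Submission where

open import Defs
open import Data.Bool.Base using (if_then_else_)
open import Data.Fin.Base using (zero; suc; splitAt; _↑ˡ_; _↑ʳ_)
open import Data.Fin.Properties using (any?)
open import Data.List.Base using (catMaybes)
open import Data.Maybe.Base using (Maybe; just; nothing)
open import Data.Nat.Base using (zero; suc)
open import Data.Product.Base using (∃; _×_; _,_; proj₁; proj₂)
open import Data.Sum.Base using (_⊎_; inj₁; inj₂; [_,_]′)
open import Data.Vec.Functional using (Vector; _++_; toList; fromList)
open import Data.Vec.Functional.Properties using (lookup-++ˡ; lookup-++ʳ)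
open import Data.Vec.Functional.Relation.Unary.All using (All)
import Data.Vec.Functional.Relation.Unary.All.Properties as All
open import Data.Vec.Functional.Relation.Unary.Any using (Any)
open import Function.Base using (_∘_)
open import Relation.Binary.Construct.Closure.ReflexiveTransitive using (ε; _◅_)
open import Relation.Binary.PropositionalEquality
  using (_≡_; refl; sym; trans; cong; subst)
open import Relation.Nullary using (¬_; Dec; does; contradiction)
open import Relation.Nullary.Decidable using (dec-true; dec-false; decidable-stable)
open ConwayForm using (game)

-- Membership in concatenated and filtered families of options

Any-++⁺ˡ : ∀ {A : Set} (P : A → Set) {m n} (xs : Vector A m) (ys : Vector A n) →
           Any P xs → Any P (xs ++ ys)
Any-++⁺ˡ P {n = n} xs ys (i , p) = i ↑ˡ n , subst P (sym (lookup-++ˡ xs ys i)) p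

Any-++⁺ʳ : ∀ {A : Set} (P : A → Set) {m n} (xs : Vector A m) (ys : Vector A n) →
           Any P ys → Any P (xs ++ ys)
Any-++⁺ʳ P {m = m} xs ys (i , p) = m ↑ʳ i , subst P (sym (lookup-++ʳ xs ys i)) p

Any-++⁻ : ∀ {A : Set} (P : A → Set) {m n} (xs : Vector A m) (ys : Vector A n) →
          Any P (xs ++ ys) → Any P xs ⊎ Any P ys
Any-++⁻ P {m = m} xs ys (i , p) with splitAt m i
... | inj₁ j = inj₁ (j , p)
... | inj₂ j = inj₂ (j , p)

∈-catMaybes⁺ : ∀ {A : Set} {n a} (f : Vector (Maybe A) n) i → f i ≡ just a →
               ∃ λ k → fromList (catMaybes (toList f)) k ≡ a
∈-catMaybes⁺ f zero eq with f zero
∈-catMaybes⁺ f zero refl | just a = zero , refl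
∈-catMaybes⁺ f (suc i) eq with f zero | ∈-catMaybes⁺ (f ∘ suc) i eq
... | just _  | k , p = suc k , p
... | nothing | k , p = k , p

∈-catMaybes⁻ : ∀ {A : Set} {n} (f : Vector (Maybe A) n) k →
               ∃ λ i → f i ≡ just (fromList (catMaybes (toList f)) k)
∈-catMaybes⁻ {n = suc n} f k with f zero in eq
∈-catMaybes⁻ {n = suc n} f zero    | just a = zero , eq
∈-catMaybes⁻ {n = suc n} f (suc k) | just a with ∈-catMaybes⁻ (f ∘ suc) k
... | i , p = suc i , p
∈-catMaybes⁻ {n = suc n} f k       | nothing with ∈-catMaybes⁻ (f ∘ suc) k
... | i , p = suc i , p

-- Outcomes of forms and of their sums

FirstWin SecondWin : Game → Set
FirstWin  G = oᴸ G ≡ 𝐋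
SecondWin G = oᴿ G ≡ 𝐋

module _ {A : Set} (d : Dec A) {w v : Winner} where

  if-does⁺ : A → (if does d then w else v) ≡ w
  if-does⁺ a = cong (if_then w else v) (dec-true d a)

  if-¬does⁺ : ¬ A → (if does d then w else v) ≡ v
  if-¬does⁺ ¬a = cong (if_then w else v) (dec-false d ¬a)

  if-does⁻ : (if does d then w else v) ≡ w → ¬ (v ≡ w) → A
  if-does⁻ eq v≢w = decidable-stable d λ ¬a → v≢w (trans (sym (if-¬does⁺ ¬a)) eq)

  if-¬does⁻ : (if does d then w else v) ≡ v → ¬ (w ≡ v) → ¬ A
  if-¬does⁻ eq w≢v a = w≢v (trans (sym (if-does⁺ a)) eq)

module _ {m n} (ls : Vector Game (suc m)) (rs : Vector Game (suc n)) where

  FirstWin⁺ : Any SecondWin ls → FirstWin ⟨ ls ∣ rs ⟩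
  FirstWin⁺ = if-does⁺ (any? λ i → oᴿ (ls i) ≟ 𝐋)

  FirstWin⁻ : FirstWin ⟨ ls ∣ rs ⟩ → Any SecondWin ls
  FirstWin⁻ eq = if-does⁻ (any? λ i → oᴿ (ls i) ≟ 𝐋) eq λ ()

  SecondWin⁺ : All FirstWin rs → SecondWin ⟨ ls ∣ rs ⟩
  SecondWin⁺ win = if-¬does⁺ (any? λ j → oᴸ (rs j) ≟ 𝐑) loses
    where
    loses : ¬ ∃ λ j → oᴸ (rs j) ≡ 𝐑
    loses (j , eq) with () ← trans (sym eq) (win j)

  -- Since `Winner` has only two values, the absence of a Right option with `oᴸ` equal to `𝐑` yields
  -- `𝐋` at each of them constructively.
  SecondWin⁻ : SecondWin ⟨ ls ∣ rs ⟩ → All FirstWin rs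
  SecondWin⁻ eq j with oᴸ (rs j) in eq′
  ... | 𝐋 = refl
  ... | 𝐑 = contradiction (j , eq′) (if-¬does⁻ (any? λ j → oᴸ (rs j) ≟ 𝐑) eq λ ())

module _ {m n m′ n′}
         (gl : Vector Game (suc m)) (gr : Vector Game (suc n))
         (hl : Vector Game (suc m′)) (hr : Vector Game (suc n′)) where

  private
    G = ⟨ gl ∣ gr ⟩
    H = ⟨ hl ∣ hr ⟩

  lefts rights : Vector Game _
  lefts  = (λ i → sum (gl i) H (summableʳ form)) ++ (λ i → sum G (hl i) (summableˡ form))
  rights = (λ j → sum (gr j) H (summableʳ form)) ++ (λ j → sum G (hr j) (summableˡ form))

  FirstWin-sum⁻ : FirstWin (sum G H (summableˡ form)) →
                  (∃ λ i → SecondWin (sum (gl i) H (summableʳ form))) ⊎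
                  (∃ λ i → SecondWin (sum G (hl i) (summableˡ form)))
  FirstWin-sum⁻ w = Any-++⁻ SecondWin _ _ (FirstWin⁻ lefts rights w)

  SecondWin-sum⁺ : (∀ j → FirstWin (sum (gr j) H (summableʳ form))) →
                   (∀ j → FirstWin (sum G (hr j) (summableˡ form))) →
                   SecondWin (sum G H (summableˡ form))
  SecondWin-sum⁺ w w′ = SecondWin⁺ lefts rights (All.++⁺ FirstWin w w′)

  SecondWin-sum⁻ : SecondWin (sum G H (summableˡ form)) →
                   (∀ j → FirstWin (sum (gr j) H (summableʳ form))) ×
                   (∀ j → FirstWin (sum G (hr j) (summableˡ form)))
  SecondWin-sum⁻ w = All.++⁻ FirstWin _ (SecondWin⁻ lefts rights w)

-- The other summand enters through `NonTerminal` rather than through its options: in `mirror` it is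
-- known only by a correspondence.
FirstWin-sum⁺ˡ : ∀ {m n} (gl : Vector Game (suc m)) (gr : Vector Game (suc n))
                 {H} (nt : NonTerminal H) i →
                 SecondWin (sum (gl i) H (summableʳ nt)) →
                 FirstWin (sum ⟨ gl ∣ gr ⟩ H (summableˡ form))
FirstWin-sum⁺ˡ gl gr (form {ls = hl} {hr}) i w =
  FirstWin⁺ (lefts gl gr hl hr) (rights gl gr hl hr) (Any-++⁺ˡ SecondWin _ _ (i , w))

FirstWin-sum⁺ʳ : ∀ {m n} {G} (nt : NonTerminal G)
                 (hl : Vector Game (suc m)) (hr : Vector Game (suc n)) i →
                 SecondWin (sum G (hl i) (summableˡ nt)) →
                 FirstWin (sum G ⟨ hl ∣ hr ⟩ (summableʳ form))
FirstWin-sum⁺ʳ (form {ls = gl} {gr}) hl hr i w =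
  FirstWin⁺ (lefts gl gr hl hr) (rights gl gr hl hr)
    (Any-++⁺ʳ SecondWin (λ i → sum (gl i) ⟨ hl ∣ hr ⟩ (summableʳ form)) _ (i , w))

-- Winning strategies on sums of classical games

module _ {m n m′ n′} {gl : Vector Short m} {gr : Vector Short n}
         {hl : Vector Short m′} {hr : Vector Short n′} where

  private
    G = ⟪ gl ∣ gr ⟫
    H = ⟪ hl ∣ hr ⟫

  LeftWinsFirst-+⁺ˡ : ∀ i → LeftWinsSecond (gl i + H) → LeftWinsFirst (G + H)
  LeftWinsFirst-+⁺ˡ i w = Any-++⁺ˡ LeftWinsSecond (λ i → gl i + H) (λ i → G + hl i) (i , w)

  LeftWinsFirst-+⁺ʳ : ∀ i → LeftWinsSecond (G + hl i) → LeftWinsFirst (G + H)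
  LeftWinsFirst-+⁺ʳ i w = Any-++⁺ʳ LeftWinsSecond (λ i → gl i + H) (λ i → G + hl i) (i , w)

  LeftWinsFirst-+⁻ : LeftWinsFirst (G + H) →
                     (∃ λ i → LeftWinsSecond (gl i + H)) ⊎
                     (∃ λ i → LeftWinsSecond (G + hl i))
  LeftWinsFirst-+⁻ = Any-++⁻ LeftWinsSecond (λ i → gl i + H) (λ i → G + hl i)

  LeftWinsSecond-+⁺ : (∀ j → LeftWinsFirst (gr j + H)) →
                      (∀ j → LeftWinsFirst (G + hr j)) →
                      LeftWinsSecond (G + H)
  LeftWinsSecond-+⁺ = All.++⁺ LeftWinsFirst

  LeftWinsSecond-+⁻ : LeftWinsSecond (G + H) →
                      (∀ j → LeftWinsFirst (gr j + H)) ×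
                      (∀ j → LeftWinsFirst (G + hr j))
  LeftWinsSecond-+⁻ = All.++⁻ LeftWinsFirst (λ j → gr j + H)

-- Corresponding games

infix 4 _∼_

-- Options are matched as sets, in both directions, so neither indices nor multiplicities need
-- agree. As terminal games have no partner, the first and third premises also exclude checks.
data _∼_ : Game → Short → Set where
  match : ∀ {m n m′ n′}
            {ls : Vector Game (suc m)} {rs : Vector Game (suc n)}
            {sl : Vector Short m′} {sr : Vector Short n′} →
          (∀ i → ls i ≡ ∞̄ ⊎ ∃ λ k → ls i ∼ sl k) →
          (∀ k → ∃ λ i → ls i ∼ sl k) →
          (∀ j → rs j ≡ ∞ ⊎ ∃ λ k → rs j ∼ sr k) →
          (∀ k → ∃ λ j → rs j ∼ sr k) →
          ⟨ ls ∣ rs ⟩ ∼ ⟪ sl ∣ sr ⟫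

∼-nonTerminal : ∀ {A S} → A ∼ S → NonTerminal A
∼-nonTerminal (match _ _ _ _) = form

-- Next to a form, `∞̄` makes the whole sum `∞̄`, a loss for Left. So a winning move of Left leads
-- to an option with a classical partner.
SecondWin⇒liveˡ : ∀ {A X} {P : Set} → A ≡ ∞̄ ⊎ P → (nt : NonTerminal X) →
                  SecondWin (sum A X (summableʳ nt)) → P
SecondWin⇒liveˡ (inj₁ refl) form ()
SecondWin⇒liveˡ (inj₂ p)    _    _ = p

SecondWin⇒liveʳ : ∀ {A X} {P : Set} → X ≡ ∞̄ ⊎ P → (nt : NonTerminal A) →
                  SecondWin (sum A X (summableˡ nt)) → P
SecondWin⇒liveʳ (inj₁ refl) form ()
SecondWin⇒liveʳ (inj₂ p)    _    _ = p

FirstWin-∞+ : ∀ {A X} → A ≡ ∞ → (nt : NonTerminal X) →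
              FirstWin (sum A X (summableʳ nt))
FirstWin-∞+ refl form = refl

FirstWin-+∞ : ∀ {A X} → X ≡ ∞ → (nt : NonTerminal A) →
              FirstWin (sum A X (summableˡ nt))
FirstWin-+∞ refl form = refl

embed-∼ : ∀ S → embed S ∼ S
embed-∼ (⟪_∣_⟫ {zero}  {zero}  ls rs) =
  match (λ _ → inj₁ refl) (λ ()) (λ _ → inj₁ refl) (λ ())
embed-∼ (⟪_∣_⟫ {zero}  {suc n} ls rs) =
  match (λ _ → inj₁ refl) (λ ())
        (λ j → inj₂ (j , embed-∼ (rs j))) (λ j → j , embed-∼ (rs j))
embed-∼ (⟪_∣_⟫ {suc m} {zero}  ls rs) =
  match (λ i → inj₂ (i , embed-∼ (ls i))) (λ i → i , embed-∼ (ls i))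
        (λ _ → inj₁ refl) (λ ())
embed-∼ (⟪_∣_⟫ {suc m} {suc n} ls rs) =
  match (λ i → inj₂ (i , embed-∼ (ls i))) (λ i → i , embed-∼ (ls i))
        (λ j → inj₂ (j , embed-∼ (rs j))) (λ j → j , embed-∼ (rs j))

NoChecks : Game → Set
NoChecks G = ∀ {F} → Follower G F → ¬ Check F

-- Followers of an option are followers of `G`, so the absence of checks is inherited and induction
-- applies. At the root it leaves `∞̄` as Left's only possible terminal option and `∞` as Right's,
-- exactly those that `match` tolerates.
convert-∼ : ∀ G → NoChecks G → ∀ {S} → convert G ≡ just S → G ∼ S
convert-∼ ⟨ ls ∣ rs ⟩ nc refl = match leftTo leftFrom rightTo rightFrom
  where
  sl : Vector Short _
  sl = fromList (catMaybes (toList λ i → convert (ls i)))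

  sr : Vector Short _
  sr = fromList (catMaybes (toList λ j → convert (rs j)))

  left : ∀ i {S} → convert (ls i) ≡ just S → ls i ∼ S
  left i = convert-∼ (ls i) λ p → nc (inj₁ (i , refl) ◅ p)

  right : ∀ j {S} → convert (rs j) ≡ just S → rs j ∼ S
  right j = convert-∼ (rs j) λ p → nc (inj₂ (j , refl) ◅ p)

  leftTo : ∀ i → ls i ≡ ∞̄ ⊎ ∃ λ k → ls i ∼ sl k
  -- Abstracting `left i` along with `ls i` specialises its statement in each case.
  leftTo i with ls i in eq | left i
  ... | ∞         | _ = contradiction (inj₁ (i , eq)) (nc ε)
  ... | ∞̄         | _ = inj₁ refl
  ... | ⟨ _ ∣ _ ⟩ | l
    with k , q ← ∈-catMaybes⁺ (λ i → convert (ls i)) i (cong convert eq)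
    = inj₂ (k , l (cong just (sym q)))

  leftFrom : ∀ k → ∃ λ i → ls i ∼ sl k
  leftFrom k with i , p ← ∈-catMaybes⁻ (λ i → convert (ls i)) k = i , left i p

  rightTo : ∀ j → rs j ≡ ∞ ⊎ ∃ λ k → rs j ∼ sr k
  rightTo j with rs j in eq | right j
  ... | ∞         | _ = inj₁ refl
  ... | ∞̄         | _ = contradiction (inj₂ (j , eq)) (nc ε)
  ... | ⟨ _ ∣ _ ⟩ | r
    with k , q ← ∈-catMaybes⁺ (λ j → convert (rs j)) j (cong convert eq)
    = inj₂ (k , r (cong just (sym q)))

  rightFrom : ∀ k → ∃ λ j → rs j ∼ sr k
  rightFrom k with j , p ← ∈-catMaybes⁻ (λ j → convert (rs j)) k = j , right j p

c-∼ : ∀ G → game G ∼ c G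
c-∼ record { game = ∞ ; nonTerminal = () }
c-∼ record { game = ∞̄ ; nonTerminal = () }
c-∼ record { game = G@(⟨ _ ∣ _ ⟩) ; noChecks = nc } = convert-∼ G nc refl

-- Comparing the two kinds of sums

-- In both mutual blocks the recursion is on the classical games (and on X),
-- not on the proofs of correspondence: the index k bounds the recursive call
-- even when its proof is obtained by a lemma.  A with-clause would hide this,
-- since it passes on the parts of the matched arguments instead of themselves.
mutual
  ∼-LeftWinsFirst : ∀ {A S B T} (p : A ∼ S) → B ∼ T →
                    FirstWin (sum A B (summableˡ (∼-nonTerminal p))) →
                    LeftWinsFirst (S + T)
  ∼-LeftWinsFirst p@(match {ls = ls} {rs} al _ _ _) q@(match {ls = ls′} {rs′} bl _ _ _) w =
    [ (λ (i , w′) →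
         let k , p′ = SecondWin⇒liveˡ (al i) form w′
         in LeftWinsFirst-+⁺ˡ k (∼-LeftWinsSecond p′ q w′))
    , (λ (i , w′) →
         let k , q′ = SecondWin⇒liveʳ (bl i) (form {ls = ls} {rs}) w′
         in LeftWinsFirst-+⁺ʳ k (∼-LeftWinsSecond p q′ w′))
    ]′ (FirstWin-sum⁻ ls rs ls′ rs′ w)

  ∼-LeftWinsSecond : ∀ {A S B T} (p : A ∼ S) → B ∼ T →
                     SecondWin (sum A B (summableˡ (∼-nonTerminal p))) →
                     LeftWinsSecond (S + T)
  ∼-LeftWinsSecond p@(match {ls = ls} {rs} _ _ _ ar) q@(match {ls = ls′} {rs′} _ _ _ br) w =
    -- Every classical move of Right has an affine partner, and Left's answer to that partner is
    -- carried over.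
    LeftWinsSecond-+⁺
      (λ k → let j , p′ = ar k in
             ∼-LeftWinsFirst p′ q (proj₁ (SecondWin-sum⁻ ls rs ls′ rs′ w) j))
      (λ k → let j , q′ = br k in
             ∼-LeftWinsFirst p q′ (proj₂ (SecondWin-sum⁻ ls rs ls′ rs′ w) j))

-- The Left options of `- S` are the negatives of the Right options of `S`, and conversely, so Left
-- answers each move of Right in the other summand. If Right moves to `∞`, Left has already won.
mirror : ∀ {A B S} (p : A ∼ S) → B ∼ - S →
         SecondWin (sum A B (summableˡ (∼-nonTerminal p)))
mirror {A} {B} (match {ls = ls} {rs} _ al ar _) (match {ls = ls′} {rs′} _ bl br _) =
  SecondWin-sum⁺ ls rs ls′ rs′ first second
  where
  first : ∀ j → FirstWin (sum (rs j) B (summableʳ form))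
  first j with ar j
  ... | inj₁ eq = FirstWin-∞+ eq form
  ... | inj₂ (k , p′) with i , q′ ← bl k =
    FirstWin-sum⁺ʳ (∼-nonTerminal p′) ls′ rs′ i (mirror p′ q′)

  second : ∀ j → FirstWin (sum A (rs′ j) (summableˡ form))
  second j with br j
  ... | inj₁ eq = FirstWin-+∞ eq (form {ls = ls} {rs})
  ... | inj₂ (k , q′) with i , p′ ← al k =
    FirstWin-sum⁺ˡ ls rs (∼-nonTerminal q′) i (mirror p′ q′)

mutual
  -- `X` may be terminal here, because the induction passes to options of `X`; the sum is then `X`
  -- itself.
  FirstWin-mono : ∀ {A S B T} (p : A ∼ S) (q : B ∼ T) X → S ≥ᴺ T →
                  FirstWin (sum B X (summableˡ (∼-nonTerminal q))) →
                  FirstWin (sum A X (summableˡ (∼-nonTerminal p)))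
  FirstWin-mono (match _ _ _ _) (match _ _ _ _) ∞ _ _ = refl
  FirstWin-mono (match _ _ _ _) (match _ _ _ _) ∞̄ _ ()
  FirstWin-mono p@(match _ _ _ _) q@(match {ls = ls} {rs} bl _ _ _) ⟨ xl ∣ xr ⟩ g w =
    [ (λ (i , w′) →
         let k , q′ = SecondWin⇒liveˡ (bl i) form w′
         -- Left's move in `B` is, negated, a move of Right in `S - T`, and `g` provides the answer.
         in FirstWin-reply p q′ form (proj₂ (LeftWinsSecond-+⁻ g) k) w′)
    , (λ (i , w′) → FirstWin-sum⁺ʳ form xl xr i (SecondWin-mono p q (xl i) g w′))
    ]′ (FirstWin-sum⁻ ls rs xl xr w)

  SecondWin-mono : ∀ {A S B T} (p : A ∼ S) (q : B ∼ T) X → S ≥ᴺ T →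
                   SecondWin (sum B X (summableˡ (∼-nonTerminal q))) →
                   SecondWin (sum A X (summableˡ (∼-nonTerminal p)))
  SecondWin-mono (match _ _ _ _) (match _ _ _ _) ∞ _ _ = refl
  SecondWin-mono (match _ _ _ _) (match _ _ _ _) ∞̄ _ ()
  SecondWin-mono p@(match {ls = ls} {rs} _ _ ar _) q@(match {ls = ls′} {rs′} _ _ _ _) ⟨ xl ∣ xr ⟩ g w =
    SecondWin-sum⁺ ls rs xl xr
      -- A move of Right in `A` is also one in `S - T`; `g` answers it while `B + X` stays as it is.
      (λ j → [ (λ eq → FirstWin-∞+ eq form)
             , (λ (k , p′) → FirstWin-reply p′ q form (proj₁ (LeftWinsSecond-+⁻ g) k) w)
             ]′ (ar j))
      (λ j → FirstWin-mono p q (xr j) g (proj₂ (SecondWin-sum⁻ ls′ rs′ xl xr w) j))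

  -- If the winning move in `S - T` lies in `S`, Left plays its partner in `A`. If it lies in `- T`,
  -- it is a move of Right in `T`: its partner is played in the imagined game `B + X`, and Left is
  -- then to move in both sums.
  FirstWin-reply : ∀ {A S B T X} → A ∼ S → B ∼ T → (nt : NonTerminal X) →
                   LeftWinsFirst (S - T) →
                   SecondWin (sum B X (summableʳ nt)) →
                   FirstWin (sum A X (summableʳ nt))
  FirstWin-reply p@(match {ls = ls} {rs} _ al _ _) q@(match {ls = ls′} {rs′} _ _ _ br)
                 (form {ls = xl} {xr}) g w =
    [ (λ (k , g′) →
         let i , p′ = al k
         in FirstWin-sum⁺ˡ ls rs form i (SecondWin-mono p′ q ⟨ xl ∣ xr ⟩ g′ w))
    , (λ (k , g′) →
         let j , q′ = br k
         in FirstWin-mono p q′ ⟨ xl ∣ xr ⟩ g′ (proj₁ (SecondWin-sum⁻ ls′ rs′ xl xr w) j))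
    ]′ (LeftWinsFirst-+⁻ g)

-- From winning strategies to the two orders

≥ʷ⁺ : ∀ {w v} → (v ≡ 𝐋 → w ≡ 𝐋) → w ≥ʷ v
≥ʷ⁺ {𝐋} {𝐋} _ = ≥-refl
≥ʷ⁺ {𝐋} {𝐑} _ = 𝐋≥𝐑
≥ʷ⁺ {𝐑} {𝐑} _ = ≥-refl
≥ʷ⁺ {𝐑} {𝐋} f with () ← f refl

≥ʷ⁻ : ∀ {w v} → w ≥ʷ v → v ≡ 𝐋 → w ≡ 𝐋
≥ʷ⁻ ≥-refl eq = eq
≥ʷ⁻ 𝐋≥𝐑 _ = refl

∼-≥ᴬ : ∀ {A S B T} → A ∼ S → B ∼ T → S ≥ᴺ T → A ≥ᴬ B
∼-≥ᴬ p q g X _ = ≥ʷ⁺ (FirstWin-mono p q X g) , ≥ʷ⁺ (SecondWin-mono p q X g)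

∼-≥ᴺ : ∀ {A S B T} → A ∼ S → B ∼ T → A ≥ᴬ B → S ≥ᴺ T
∼-≥ᴺ {T = T} p q g =
  ∼-LeftWinsSecond p x (≥ʷ⁻ (proj₂ (g X (∼-nonTerminal x))) (mirror q x))
  where
  -- Any form corresponding to `- T` would serve; `embed` supplies one.
  X = embed (- T)
  x = embed-∼ (- T)

theorem49 : (∀ (G H : ConwayForm) → game G ≥ᴬ game H → c G ≥ᴺ c H)
    × (∀ (G H : Short) → G ≥ᴺ H → game (c⁻¹ G) ≥ᴬ game (c⁻¹ H))
theorem49 = (λ G H → ∼-≥ᴺ (c-∼ G) (c-∼ H)) , (λ G H → ∼-≥ᴬ (embed-∼ G) (embed-∼ H))
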